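{- Let $s<t$ be relatively prime positive integers and $n$ a positive integer. Let $M\Delta_n$ be the largest (under partition-wise containment $\prec$) delta-set containing exactly $n$ elements. Then for any $(s,t)$-closed beta-set $\beta$ containing $n$ elements, $\beta\prec\overline{M\Delta_n+s}$.
   Context: A beta-set is a finite set of positive integers, written in decreasing order $\beta=\{\beta_1>\dots>\beta_n\}$; its associated partition is $P(\beta)=(\beta_1-(n-1),\dots,\beta_n)$. For partitions $P=(P_1,\dots,P_n)$, $Q=(Q_1,\dots,Q_m)$ write $P<Q$ if $n\le m$ and $P_i\le Q_i$ for all $i\le n$; for beta-sets $\beta\prec\gamma$ means $P(\beta)<P(\gamma)$. A beta-set $\beta$ is $(s,t)$-closed if for every $x\in\beta$: $x>s$ implies $x-s\in\beta$ and $x>t$ implies $x-t\in\beta$. The $(s,t)$-closure of a set $\beta$ of positive integers is $\overline{\beta}=\{x-as-bt : x\in\beta,\ a,b\ge0,\ x>as+bt\}$. A delta-set is a set $\overline{\{g\}}$ with $g$ a positive integer (its generator). For a set $\beta$ and positive integer $k$, $\beta+k=\{x+k:x\in\beta\}$. -}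

module Defs where

open import Data.Nat using (ℕ; zero; suc; _+_; _*_; _∸_; _≤_; _<_; _>_)
open import Data.List using (List; []; _∷_; length; map)
open import Data.List.Membership.Propositional using (_∈_)
open import Data.List.Relation.Unary.All using (All)
open import Data.List.Relation.Unary.Linked using (Linked)
open import Data.Product using (Σ; ∃; _×_; _,_)
open import Function.Bundles using (_⇔_)
open import Relation.Binary.PropositionalEquality using (_≡_)

-- A finite set of positive integers, represented canonically as a
-- strictly decreasing list of positive naturals (β₁ > β₂ > … > βₙ ≥ 1).
IsBetaSet : List ℕ → Set
IsBetaSet β = Linked _>_ β × All (λ x → 1 ≤ x) β

NSet : Set₁
NSet = ℕ → Set

Represents : List ℕ → NSet → Set
Represents β S = IsBetaSet β × (∀ x → (x ∈ β) ⇔ S x)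

partition : List ℕ → List ℕ
partition []       = []
partition (x ∷ xs) = (x ∸ length xs) ∷ partition xs

data _<P_ : List ℕ → List ℕ → Set where
  []<P  : ∀ {Q} → [] <P Q
  ∷<P   : ∀ {p q P Q} → p ≤ q → P <P Q → (p ∷ P) <P (q ∷ Q)

_≺_ : List ℕ → List ℕ → Set
β ≺ γ = partition β <P partition γ

_+ₛ_ : List ℕ → ℕ → List ℕ
β +ₛ k = map (_+ k) β

module _ (s t : ℕ) where

  IsClosed : List ℕ → Set
  IsClosed β = ∀ x → x ∈ β → (s < x → (x ∸ s) ∈ β) × (t < x → (x ∸ t) ∈ β)

  closure : List ℕ → NSet
  closure β y = Σ ℕ λ x → Σ ℕ λ a → Σ ℕ λ b →
    x ∈ β × (a * s + b * t < x) × (y ≡ x ∸ (a * s + b * t))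

  IsDeltaSet : List ℕ → Set
  IsDeltaSet D = Σ ℕ λ g → 1 ≤ g × Represents D (closure (g ∷ []))

  IsMaxDelta : ℕ → List ℕ → Set
  IsMaxDelta n D = IsDeltaSet D × length D ≡ n ×
    (∀ D' → IsDeltaSet D' → length D' ≡ n → D' ≺ D)

{-# OPTIONS --safe #-}

-- Let W = {as + bt}, V(v) = #{w ∈ W : w < v} and w₁ < w₂ < … the elements of W. The delta-set of
-- g is {g - w : w ∈ W, w < g}, so maximality forces g = w_{n+1}, that is g ∈ W and V(g) = n,
-- and the closure of MΔ + s is the delta-set of g + s. Since a part of a partition counts the gaps
-- below an element, it suffices that an x ∈ β with i elements of β at or above it has a u
-- with V(u) = i and u + x + (V(g + s) - n) ≤ g + s.
--
-- To find u, compare c(p) = #β ∩ [p, p + s), with nonpositive integers counted into β, and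
-- f(v) = #W ∩ [v - s, v). As s and t are coprime, a nonempty window that is not full gains an element
-- when moved by t, so c(p + t) < c(p), while f(v) < f(v + t) ≤ f(v) + 1. Hence for a suitable e the profile
-- f(e - p) dominates c(p) for p ≥ x and is dominated by it for p ≤ x. Summing windows above x
-- gives i ≤ V(e - x), hence a u ≤ e - x with V(u) = i; summing windows below x bounds V at
-- u + qs and at u + (q + 1)s, where q is the quotient of x - 1 by s, and V grows with slope at most 1.
module Submission where

open import Defs
open import Data.Nat
open import Data.Nat.Properties
open import Data.Nat.Coprimality using (Coprime; coprime-Bézout)
open import Data.Nat.Divisibility using (_∣_; _∣?_; divides; ∣m+n∣m⇒∣n; ∣-refl; >⇒∤)
open import Data.Nat.DivMod using (_%_; _/_; m≡m%n+[m/n]*n; m%n<n; m<n⇒m%n≡m; [m+kn]%n≡m%n)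
open import Data.Nat.GCD using (module Bézout)
open import Data.Nat.Tactic.RingSolver using (solve-∀)
open import Data.List using (List; []; _∷_; length)
open import Data.List.Extrema.Nat using (max; xs≤max)
open import Data.List.Membership.DecPropositional _≟_ using (_∈?_)
open import Data.List.Membership.Propositional using (_∈_)
open import Data.List.Membership.Propositional.Properties using (∈-map⁺; ∈-map⁻)
open import Data.List.Relation.Unary.All as All using (All)
open import Data.List.Relation.Unary.AllPairs using (AllPairs; []; _∷_)
open import Data.List.Relation.Unary.Any using (here; there)
open import Data.List.Relation.Unary.Linked.Properties using (AllPairs⇒Linked; Linked⇒AllPairs)
open import Data.Product using (Σ; ∃; _×_; _,_; proj₁; proj₂)
open import Data.Sum using (_⊎_; inj₁; inj₂)
open import Function using (_∘_)
open import Function.Bundles using (_⇔_; mk⇔; Equivalence)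
open import Relation.Nullary using (¬_; Dec; yes; no; contradiction; ¬?; _×-dec_; _⊎-dec_)
open import Relation.Nullary.Decidable using (decidable-stable; map′)
open import Relation.Unary using (Decidable)
open import Relation.Binary.PropositionalEquality

-- Counting decidable predicates on initial segments.

variable
  A A′ : Set
  P Q R : ℕ → Set

indicator : Dec A → ℕ
indicator (yes _) = 1
indicator (no  _) = 0

indicator-mono : (d : Dec A) (d′ : Dec A′) → (A → A′) → indicator d ≤ indicator d′
indicator-mono (yes a) (yes _) _ = ≤-refl
indicator-mono (yes a) (no ¬a) f = contradiction (f a) ¬a
indicator-mono (no _)  _       _ = z≤n

indicator-cong : (d : Dec A) (d′ : Dec A′) → A ⇔ A′ → indicator d ≡ indicator d′
indicator-cong d d′ e =
  ≤-antisym (indicator-mono d d′ (Equivalence.to e)) (indicator-mono d′ d (Equivalence.from e))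

indicator≤1 : (d : Dec A) → indicator d ≤ 1
indicator≤1 (yes _) = ≤-refl
indicator≤1 (no _)  = z≤n

indicator-yes : (d : Dec A) → A → indicator d ≡ 1
indicator-yes (yes _) _ = refl
indicator-yes (no ¬a) a = contradiction a ¬a

indicator-no : (d : Dec A) → ¬ A → indicator d ≡ 0
indicator-no (yes a) ¬a = contradiction a ¬a
indicator-no (no _)  _  = refl

count : Decidable P → ℕ → ℕ
count P? zero    = 0
count P? (suc m) = indicator (P? m) + count P? m

count-+ : (P? : Decidable P) → ∀ p l → count P? (p + l) ≡ count P? p + count (λ j → P? (p + j)) l
count-+ P? p zero rewrite +-identityʳ p = sym (+-identityʳ _)
count-+ P? p (suc l) rewrite +-suc p l | count-+ P? p l =
  x∙yz≈y∙xz (indicator (P? (p + l))) (count P? p) _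
  where open import Algebra.Properties.CommutativeSemigroup +-commutativeSemigroup

count≤ : (P? : Decidable P) → ∀ m → count P? m ≤ m
count≤ P? zero    = z≤n
count≤ P? (suc m) = +-mono-≤ (indicator≤1 (P? m)) (count≤ P? m)

count-mono : (P? : Decidable P) → ∀ {p q} → p ≤ q → count P? p ≤ count P? q
count-mono P? {p} p≤q with m≤n⇒∃[o]m+o≡n p≤q
... | o , refl = subst (count P? p ≤_) (sym (count-+ P? p o)) (m≤m+n _ _)

count-+-≤ : (P? : Decidable P) → ∀ p l → count P? (p + l) ≤ count P? p + l
count-+-≤ P? p l =
  subst (_≤ count P? p + l) (sym (count-+ P? p l)) (+-monoʳ-≤ (count P? p) (count≤ _ l))

count-cancel-< : (P? : Decidable P) → ∀ {p q} → count P? p < count P? q → p < q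
count-cancel-< P? {p} {q} lt with p <? q
... | yes p<q = p<q
... | no  p≮q = contradiction lt (≤⇒≯ (count-mono P? (≮⇒≥ p≮q)))

count-⊆ : (P? : Decidable P) (Q? : Decidable Q) → ∀ m → (∀ {j} → j < m → P j → Q j) →
          count P? m ≤ count Q? m
count-⊆ P? Q? zero    P⊆Q = z≤n
count-⊆ P? Q? (suc m) P⊆Q =
  +-mono-≤ (indicator-mono (P? m) (Q? m) (P⊆Q ≤-refl)) (count-⊆ P? Q? m (P⊆Q ∘ m≤n⇒m≤1+n))

count-cong : (P? : Decidable P) (Q? : Decidable Q) → ∀ m → (∀ {j} → j < m → P j ⇔ Q j) →
             count P? m ≡ count Q? m
count-cong P? Q? m P⇔Q = ≤-antisym
  (count-⊆ P? Q? m (λ j<m → Equivalence.to (P⇔Q j<m)))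
  (count-⊆ Q? P? m (λ j<m → Equivalence.from (P⇔Q j<m)))

count-⊂ : (P? : Decidable P) (Q? : Decidable Q) → ∀ m → (∀ {j} → j < m → P j → Q j) →
          ∀ {i} → i < m → Q i → ¬ P i → count P? m < count Q? m
count-⊂ P? Q? (suc m) P⊆Q {i} i<1+m Qi ¬Pi with m≤n⇒m<n∨m≡n (s≤s⁻¹ i<1+m)
... | inj₁ i<m = +-mono-≤-< (indicator-mono (P? m) (Q? m) (P⊆Q ≤-refl))
                            (count-⊂ P? Q? m (P⊆Q ∘ m≤n⇒m≤1+n) i<m Qi ¬Pi)
... | inj₂ refl rewrite indicator-no (P? m) ¬Pi | indicator-yes (Q? m) Qi =
  s≤s (count-⊆ P? Q? m (P⊆Q ∘ m≤n⇒m≤1+n))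

count-∪ : (P? : Decidable P) (Q? : Decidable Q) (R? : Decidable R) → ∀ m →
          (∀ {j} → j < m → P j → Q j ⊎ R j) → count P? m ≤ count Q? m + count R? m
count-∪ P? Q? R? zero    P⊆Q∪R = z≤n
count-∪ P? Q? R? (suc m) P⊆Q∪R = begin
  indicator (P? m) + count P? m                                         ≤⟨ +-mono-≤ (split (P? m) (Q? m) (R? m) (P⊆Q∪R ≤-refl)) (count-∪ P? Q? R? m (P⊆Q∪R ∘ m≤n⇒m≤1+n)) ⟩
  (indicator (Q? m) + indicator (R? m)) + (count Q? m + count R? m)     ≡⟨ interchange (indicator (Q? m)) _ _ _ ⟩
  (indicator (Q? m) + count Q? m) + (indicator (R? m) + count R? m)     ∎
  where
  open ≤-Reasoning
  open import Algebra.Properties.CommutativeSemigroup +-commutativeSemigroup using (interchange)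
  split : ∀ {A B C : Set} (a : Dec A) (b : Dec B) (c : Dec C) → (A → B ⊎ C) →
          indicator a ≤ indicator b + indicator c
  split (no _)  _       _       _ = z≤n
  split (yes a) (yes _) _       _ = s≤s z≤n
  split (yes a) (no _)  (yes _) _ = ≤-refl
  split (yes a) (no ¬b) (no ¬c) f with f a
  ... | inj₁ b = contradiction b ¬b
  ... | inj₂ c = contradiction c ¬c

count-full : (P? : Decidable P) → ∀ m → (∀ {j} → j < m → P j) → count P? m ≡ m
count-full P? zero    full = refl
count-full P? (suc m) full =
  cong₂ _+_ (indicator-yes (P? m) (full ≤-refl)) (count-full P? m (full ∘ m≤n⇒m≤1+n))

count-empty : (P? : Decidable P) → ∀ m → (∀ {j} → j < m → ¬ P j) → count P? m ≡ 0
count-empty P? zero    empty = refl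
count-empty P? (suc m) empty =
  cong₂ _+_ (indicator-no (P? m) (empty ≤-refl)) (count-empty P? m (empty ∘ m≤n⇒m≤1+n))

count-∁ : (P? : Decidable P) → ∀ m → count P? m + count (¬? ∘ P?) m ≡ m
count-∁ P? zero = refl
count-∁ P? (suc m) with P? m
... | yes _ = cong suc (count-∁ P? m)
... | no  _ = trans (+-suc _ _) (cong suc (count-∁ P? m))

count-∃ : (P? : Decidable P) → ∀ m → 0 < count P? m → ∃ λ j → j < m × P j
count-∃ P? (suc m) pos with P? m
... | yes Pm = m , ≤-refl , Pm
... | no  _  with count-∃ P? m pos
...   | j , j<m , Pj = j , m≤n⇒m≤1+n j<m , Pj

-- The count starts at 0 and rises by at most one per position, so it skips no value.
count-reaches : (P? : Decidable P) → ∀ m {i} → i ≤ count P? m → ∃ λ u → u ≤ m × count P? u ≡ i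
count-reaches P? zero    z≤n = 0 , z≤n , refl
count-reaches P? (suc m) {i} i≤ with i ≤? count P? m
... | yes i≤c with count-reaches P? m i≤c
...   | u , u≤m , eq = u , m≤n⇒m≤1+n u≤m , eq
count-reaches P? (suc m) {i} i≤ | no i≰c =
  suc m , ≤-refl , ≤-antisym (≤-trans (+-monoˡ-≤ _ (indicator≤1 (P? m))) (≰⇒> i≰c)) i≤

-- The reflection `a ↦ m - 1 - a` turns `P` into `Q`, so moving the cut by one takes from one count
-- what it adds to the other.
count-reflect : (P? : Decidable P) (Q? : Decidable Q) → ∀ m →
                (∀ {a b} → suc (a + b) ≡ m → P a ⇔ Q b) →
                ∀ p v → p + v ≡ m → count P? p + count Q? v ≡ count Q? m
count-reflect P? Q? m P⇔Q zero    v refl = refl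
count-reflect P? Q? m P⇔Q (suc p) v eq = begin
  (indicator (P? p) + count P? p) + count Q? v  ≡⟨ cong (λ i → i + count P? p + count Q? v) (indicator-cong (P? p) (Q? v) (P⇔Q eq)) ⟩
  (indicator (Q? v) + count P? p) + count Q? v  ≡⟨ xy∙z≈y∙xz (indicator (Q? v)) (count P? p) _ ⟩
  count P? p + (indicator (Q? v) + count Q? v)  ≡⟨ count-reflect P? Q? m P⇔Q p (suc v) (trans (+-suc p v) eq) ⟩
  count Q? m                                    ∎
  where
  open ≡-Reasoning
  open import Algebra.Properties.CommutativeSemigroup +-commutativeSemigroup

-- Beta-sets as enumerations, and their partitions.

-- An index z stands for the element suc z, so positivity is automatic.
enumerate : Decidable P → ℕ → List ℕ
enumerate P? zero = []
enumerate P? (suc m) with P? m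
... | yes _ = suc m ∷ enumerate P? m
... | no  _ = enumerate P? m

length-enumerate : (P? : Decidable P) → ∀ m → length (enumerate P? m) ≡ count P? m
length-enumerate P? zero = refl
length-enumerate P? (suc m) with P? m
... | yes _ = cong suc (length-enumerate P? m)
... | no  _ = length-enumerate P? m

∈-enumerate⁺ : (P? : Decidable P) → ∀ m {z} → z < m → P z → suc z ∈ enumerate P? m
∈-enumerate⁺ P? (suc m) {z} z<1+m Pz with P? m | m≤n⇒m<n∨m≡n (s≤s⁻¹ z<1+m)
... | yes _  | inj₁ z<m  = there (∈-enumerate⁺ P? m z<m Pz)
... | yes _  | inj₂ refl = here refl
... | no  _  | inj₁ z<m  = ∈-enumerate⁺ P? m z<m Pz
... | no ¬Pm | inj₂ refl = contradiction Pz ¬Pm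

∈-enumerate⁻ : (P? : Decidable P) → ∀ m {y} → y ∈ enumerate P? m → ∃ λ z → y ≡ suc z × z < m × P z
∈-enumerate⁻ P? (suc m) y∈ with P? m
∈-enumerate⁻ P? (suc m) (here refl) | yes Pm = m , refl , ≤-refl , Pm
∈-enumerate⁻ P? (suc m) (there y∈)  | yes _  with ∈-enumerate⁻ P? m y∈
... | z , eq , z<m , Pz = z , eq , m≤n⇒m≤1+n z<m , Pz
∈-enumerate⁻ P? (suc m) y∈          | no _   with ∈-enumerate⁻ P? m y∈
... | z , eq , z<m , Pz = z , eq , m≤n⇒m≤1+n z<m , Pz

enumerate-isBetaSet : (P? : Decidable P) → ∀ m → IsBetaSet (enumerate P? m)
enumerate-isBetaSet P? m = AllPairs⇒Linked (decreasing m) , All.tabulate positive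
  where
  positive : ∀ {y} → y ∈ enumerate P? m → 1 ≤ y
  positive y∈ with ∈-enumerate⁻ P? m y∈
  ... | _ , refl , _ = s≤s z≤n
  below : ∀ k {y} → y ∈ enumerate P? k → y < suc k
  below k y∈ with ∈-enumerate⁻ P? k y∈
  ... | _ , refl , z<k , _ = s≤s z<k
  decreasing : ∀ k → AllPairs _>_ (enumerate P? k)
  decreasing zero = []
  decreasing (suc k) with P? k
  ... | yes _ = All.tabulate (below k) ∷ decreasing k
  ... | no  _ = decreasing k

∈-tail : ∀ {x y : ℕ} {xs} → y ∈ x ∷ xs → y ≢ x → y ∈ xs
∈-tail (here y≡x)  y≢x = contradiction y≡x y≢x
∈-tail (there y∈) _    = y∈

decreasing-unique : ∀ {β γ : List ℕ} → AllPairs _>_ β → AllPairs _>_ γ →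
                    (∀ {x} → x ∈ β → x ∈ γ) → (∀ {x} → x ∈ γ → x ∈ β) → β ≡ γ
decreasing-unique {[]}    {[]}    _ _ _ _ = refl
decreasing-unique {[]}    {y ∷ γ} _ _ _ ⊇ with () ← ⊇ (here refl)
decreasing-unique {x ∷ β} {[]}    _ _ ⊆ _ with () ← ⊆ (here refl)
decreasing-unique {x ∷ β} {y ∷ γ} (x> ∷ β↘) (y> ∷ γ↘) ⊆ ⊇ =
  cong₂ _∷_ x≡y (decreasing-unique β↘ γ↘
    (λ z∈β → ∈-tail (⊆ (there z∈β)) (λ z≡y → <⇒≢ (All.lookup x> z∈β) (trans z≡y (sym x≡y))))
    (λ z∈γ → ∈-tail (⊇ (there z∈γ)) (λ z≡x → <⇒≢ (All.lookup y> z∈γ) (trans z≡x x≡y))))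
  where
  head-max : ∀ {a b : ℕ} {as} → All (_< a) as → b ∈ a ∷ as → b ≤ a
  head-max _  (here refl) = ≤-refl
  head-max a> (there b∈)  = <⇒≤ (All.lookup a> b∈)
  x≡y : x ≡ y
  x≡y = ≤-antisym (head-max y> (⊆ (here refl))) (head-max x> (⊇ (here refl)))

betaSet-unique : ∀ {β γ} → IsBetaSet β → IsBetaSet γ → (∀ {x} → x ∈ β → x ∈ γ) → (∀ {x} → x ∈ γ → x ∈ β) → β ≡ γ
betaSet-unique (β↘ , _) (γ↘ , _) =
  decreasing-unique (Linked⇒AllPairs >-trans β↘) (Linked⇒AllPairs >-trans γ↘)
  where
  >-trans : ∀ {i j k : ℕ} → i > j → j > k → i > k
  >-trans i>j j>k = <-trans j>k i>j

enumerate-∷ : (P? : Decidable P) → ∀ m → P m → enumerate P? (suc m) ≡ suc m ∷ enumerate P? m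
enumerate-∷ P? m Pm with P? m
... | yes _  = refl
... | no ¬Pm = contradiction Pm ¬Pm

enumerate-head : (P? : Decidable P) → ∀ m → 0 < count P? m →
                 ∃ λ k → P k × enumerate P? m ≡ suc k ∷ enumerate P? k × count P? m ≡ suc (count P? k)
enumerate-head P? (suc m) pos with P? m
... | yes Pm = m , Pm , refl , refl
... | no  _  = enumerate-head P? m pos

-- The invariant `count Q? m ≡ K + count P? M` pairs elements of equal rank from the top, `K` being
-- the surplus of `Q`. By `few`, the partner `suc k` of `suc M` has `M + K ≤ k`, which makes up for
-- the `K` additional elements below it.
enumerate-≺ : (P? : Decidable P) (Q? : Decidable Q) → ∀ K →
              (∀ {z} → P z → count Q? (z + K) ≤ K + count P? z) →
              ∀ M m → count Q? m ≡ K + count P? M → enumerate P? M ≺ enumerate Q? m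
enumerate-≺ P? Q? K few zero    m eq = []<P
enumerate-≺ P? Q? K few (suc M) m eq with P? M
... | no _   = enumerate-≺ P? Q? K few M m eq
... | yes PM with enumerate-head Q? m (subst (0 <_) (sym (trans eq (+-suc K _))) (s≤s z≤n))
...   | k , Qk , list≡ , count≡ rewrite list≡ | length-enumerate P? M | length-enumerate Q? k =
  ∷<P head≤ (enumerate-≺ P? Q? K few M k count-k)
  where
  count-k : count Q? k ≡ K + count P? M
  count-k = suc-injective (trans (sym count≡) (trans eq (+-suc K _)))
  -- Only an occupied position makes the count strict, hence the detour through `suc k`.
  M+K≤k : M + K ≤ k
  M+K≤k = s≤s⁻¹ (count-cancel-< Q? (begin-strict
    count Q? (M + K)        ≤⟨ few PM ⟩
    K + count P? M          ≡⟨ count-k ⟨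
    count Q? k              <⟨ n<1+n _ ⟩
    1 + count Q? k          ≡⟨ cong (_+ count Q? k) (indicator-yes (Q? k) Qk) ⟨
    count Q? (suc k)        ∎))
    where open ≤-Reasoning
  head≤ : suc M ∸ count P? M ≤ suc k ∸ count Q? k
  head≤ rewrite count-k = begin
    suc M ∸ count P? M                 ≡⟨ sym ([m+n]∸[m+o]≡n∸o K (suc M) (count P? M)) ⟩
    (K + suc M) ∸ (K + count P? M)     ≤⟨ ∸-monoˡ-≤ (K + count P? M) (subst (_≤ suc k) (trans (cong suc (+-comm M K)) (sym (+-suc K M))) (s≤s M+K≤k)) ⟩
    suc k ∸ (K + count P? M)           ∎
    where open ≤-Reasoning

-- Windows of length `s`.

window : Decidable P → ℕ → ℕ → ℕ
window P? s p = count (λ j → P? (p + j)) s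

module _ (P? : Decidable P) (s : ℕ) (P-s : ∀ {z} → P (z + s) → P z) where

  -- Sliding by one trades position `p` for `p + s`, and by `P-s` the latter is occupied only if the
  -- former is.
  window-suc : ∀ p → window P? s (suc p) ≤ window P? s p
  window-suc p = +-cancelˡ-≤ (count P? (suc p)) _ _ (begin
    count P? (suc p) + window P? s (suc p)                   ≡⟨ count-+ P? (suc p) s ⟨
    indicator (P? (p + s)) + count P? (p + s)                ≤⟨ +-monoˡ-≤ _ (indicator-mono (P? (p + s)) (P? p) P-s) ⟩
    indicator (P? p) + count P? (p + s)                      ≡⟨ cong (indicator (P? p) +_) (count-+ P? p s) ⟩
    indicator (P? p) + (count P? p + window P? s p)          ≡⟨ +-assoc (indicator (P? p)) _ _ ⟨
    count P? (suc p) + window P? s p                         ∎)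
    where open ≤-Reasoning

  window-antitone : ∀ {p q} → p ≤ q → window P? s q ≤ window P? s p
  window-antitone {p} p≤q with m≤n⇒∃[o]m+o≡n p≤q
  ... | o , refl = go o
    where
    go : ∀ o → window P? s (p + o) ≤ window P? s p
    go zero    = ≤-reflexive (cong (window P? s) (+-identityʳ p))
    go (suc o) = ≤-trans (≤-reflexive (cong (window P? s) (+-suc p o)))
                         (≤-trans (window-suc (p + o)) (go o))

  close-* : ∀ a {z} → P (z + a * s) → P z
  close-* zero    {z} Pz = subst P (+-identityʳ z) Pz
  close-* (suc a) {z} Pz = P-s (close-* a (subst P (sym (+-assoc z s (a * s))) Pz))

-- Residues modulo `s` under translation by `t`.

module _ (s t : ℕ) .{{_ : NonZero s}} (coprime : Coprime s t) where

  -- As `t` is invertible modulo `s`, a multiple of `t` carries the residue `i` to `j`; `α` and `β`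
  -- express the congruence without subtraction.
  shift-to : ∀ i j → i < s → j < s → ∃ λ m → ∃ λ α → ∃ λ β → i + m * t + α * s ≡ j + β * s
  shift-to i j i<s j<s with coprime-Bézout coprime
  ... | Bézout.-+ x y 1+xs≡yt = h * y , 0 , 1 + h * x , (begin
    i + h * y * t + 0              ≡⟨ lem₁ i h y t ⟩
    i + h * (y * t)                ≡⟨ cong (λ z → i + h * z) 1+xs≡yt ⟨
    i + h * (1 + x * s)            ≡⟨ lem₂ i h x s ⟩
    (i + h) + h * x * s            ≡⟨ cong (_+ h * x * s) i+h ⟩
    j + s + h * x * s              ≡⟨ +-assoc j s _ ⟩
    j + (1 + h * x) * s            ∎)
    where
    open ≡-Reasoning
    -- Here `y` is an inverse of `t` modulo `s`, and `h` represents `j - i`, kept natural by adding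
    -- `s`.
    h = j + (s ∸ i)
    lem₁ : ∀ i h y t → i + h * y * t + 0 ≡ i + h * (y * t)
    lem₁ = solve-∀
    lem₂ : ∀ i h x s → i + h * (1 + x * s) ≡ (i + h) + h * x * s
    lem₂ = solve-∀
    lem₃ : ∀ i j d → i + (j + d) ≡ j + (i + d)
    lem₃ = solve-∀
    i+h : i + h ≡ j + s
    i+h = trans (lem₃ i j (s ∸ i)) (cong (j +_) (m+[n∸m]≡n (<⇒≤ i<s)))
  ... | Bézout.+- x y 1+yt≡xs = h * y , 1 , h * x , (begin
    i + h * y * t + 1 * s          ≡⟨ lem₁ i h y t s ⟩
    (i + s) + h * (y * t)          ≡⟨ cong (_+ h * (y * t)) j+h ⟨
    (j + h) + h * (y * t)          ≡⟨ lem₂ j h (y * t) ⟩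
    j + h * (1 + y * t)            ≡⟨ cong (λ z → j + h * z) 1+yt≡xs ⟩
    j + h * (x * s)                ≡⟨ cong (j +_) (*-assoc h x s) ⟨
    j + h * x * s                  ∎)
    where
    open ≡-Reasoning
    -- Here `y` is minus an inverse of `t`, so `h` represents `i - j` instead.
    h = i + (s ∸ j)
    lem₁ : ∀ i h y t s → i + h * y * t + 1 * s ≡ (i + s) + h * (y * t)
    lem₁ = solve-∀
    lem₂ : ∀ j h z → (j + h) + h * z ≡ j + h * (1 + z)
    lem₂ = solve-∀
    lem₃ : ∀ i j d → i + (j + d) ≡ j + (i + d)
    lem₃ = solve-∀
    j+h : j + h ≡ i + s
    j+h = trans (lem₃ j i (s ∸ j)) (cong (i +_) (m+[n∸m]≡n (<⇒≤ j<s)))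

  module _ (P? : Decidable P) (P-s : ∀ {z} → P (z + s) → P z) (P-t : ∀ {z} → P (z + t) → P z) where

    -- Modulo s: a nonempty set of residues invariant under translation by t is everything.
    saturate : ∀ p → (∀ {j} → j < s → P (p + j) → P (p + j + t)) →
               ∀ {i j} → i < s → P (p + i) → j < s → P (p + j)
    saturate p P+t {i} {j} i<s Pi j<s with shift-to i j i<s j<s
    ... | m , α , β , i+mt+αs≡j+βs with translates m
      where
      -- Each step by `t` is folded back into the window by subtracting multiples of `s`, which
      -- `P-s` allows.
      translates : ∀ m → ∃ λ r → ∃ λ a → r < s × P (p + r) × i + m * t ≡ r + a * s
      translates zero = i , 0 , i<s , Pi , refl
      translates (suc m) with translates m
      ... | r , a , r<s , Pr , eq =
        (r + t) % s , (r + t) / s + a , m%n<n (r + t) s ,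
        close-* P? s P-s ((r + t) / s) (subst P (begin
          p + r + t                                     ≡⟨ +-assoc p r t ⟩
          p + (r + t)                                   ≡⟨ cong (p +_) (m≡m%n+[m/n]*n (r + t) s) ⟩
          p + ((r + t) % s + (r + t) / s * s)           ≡⟨ +-assoc p _ _ ⟨
          p + (r + t) % s + (r + t) / s * s             ∎) (P+t r<s Pr)) ,
        (begin
          i + (t + m * t)                               ≡⟨ lem₁ i t (m * t) ⟩
          (i + m * t) + t                               ≡⟨ cong (_+ t) eq ⟩
          r + a * s + t                                 ≡⟨ lem₂ r (a * s) t ⟩
          (r + t) + a * s                               ≡⟨ cong (_+ a * s) (m≡m%n+[m/n]*n (r + t) s) ⟩
          (r + t) % s + (r + t) / s * s + a * s         ≡⟨ lem₃ ((r + t) % s) ((r + t) / s) a s ⟩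
          (r + t) % s + ((r + t) / s + a) * s           ∎)
        where
        open ≡-Reasoning
        lem₁ : ∀ a b c → a + (b + c) ≡ a + c + b
        lem₁ = solve-∀
        lem₂ : ∀ a b c → a + b + c ≡ a + c + b
        lem₂ = solve-∀
        lem₃ : ∀ r q a s → r + q * s + a * s ≡ r + (q + a) * s
        lem₃ = solve-∀
    ...   | r , a , r<s , Pr , eq = subst (λ z → P (p + z)) r≡j Pr
      where
      open ≡-Reasoning
      lem : ∀ r a α s → r + a * s + α * s ≡ r + (a + α) * s
      lem = solve-∀
      r≡j : r ≡ j
      r≡j = begin
        r                        ≡⟨ m<n⇒m%n≡m r<s ⟨
        r % s                    ≡⟨ [m+kn]%n≡m%n r (a + α) s ⟨
        (r + (a + α) * s) % s    ≡⟨ cong (_% s) (lem r a α s) ⟨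
        (r + a * s + α * s) % s  ≡⟨ cong (λ z → (z + α * s) % s) eq ⟨
        (i + m * t + α * s) % s  ≡⟨ cong (_% s) i+mt+αs≡j+βs ⟩
        (j + β * s) % s          ≡⟨ [m+kn]%n≡m%n j β s ⟩
        j % s                    ≡⟨ m<n⇒m%n≡m j<s ⟩
        j                        ∎

    -- By `P-t`, shifting back by `t` embeds the window at `p + t` in the one at `p`. If nothing is
    -- lost, the occupied residues are invariant under `t` and, being nonempty, fill the window by
    -- `saturate`.
    window-growth : ∀ p → 0 < window P? s (p + t) → window P? s p < s →
                    window P? s (p + t) < window P? s p
    window-growth p pos notfull
      with anyUpTo? (λ j → P? (p + j) ×-dec ¬? (P? (p + t + j))) s
    ... | yes (i , i<s , Pi , ¬Pi+t) =
      count-⊂ _ _ s (λ {j} _ P+ → P-t (subst P (swap p t j) P+)) i<s Pi ¬Pi+t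
      where
      swap : ∀ p t j → p + t + j ≡ p + j + t
      swap = solve-∀
    ... | no none with count-∃ _ s pos
    ...   | i , i<s , Pi+t = contradiction (count-full _ s full) (<⇒≢ notfull)
      where
      swap : ∀ p t j → p + t + j ≡ p + j + t
      swap = solve-∀
      full : ∀ {j} → j < s → P (p + j)
      full = saturate p
        (λ {j} j<s Pj → subst P (swap p t j)
          (decidable-stable (P? (p + t + j)) (λ ¬P → none (j , j<s , Pj , ¬P))))
        i<s (P-t (subst P (swap p t i) Pi+t))

-- Crossing of the two window profiles.

descend : ∀ (c : ℕ → ℕ) {k} x n → k < c x → c (x + n) ≤ k →
          ∃ λ δ → δ < n × k < c (x + δ) × c (x + suc δ) ≤ k
descend c x zero    k<c c≤k = contradiction (subst (λ z → c z ≤ _) (+-identityʳ x) c≤k) (<⇒≱ k<c)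
descend c {k} x (suc n) k<c c≤k with c (x + n) ≤? k
... | no  c≰k = n , ≤-refl , ≰⇒> c≰k , c≤k
... | yes c≤k′ with descend c x n k<c c≤k′
...   | δ , δ<n , rest = δ , m≤n⇒m≤1+n δ<n , rest

module Crossing
  (s t : ℕ) .{{_ : NonZero t}} (c f : ℕ → ℕ)
  (c-anti : ∀ {p q} → p ≤ q → c q ≤ c p)
  (c-growth : ∀ p → 0 < c (p + t) → c p < s → c (p + t) < c p)
  (f-mono : ∀ {u v} → u ≤ v → f u ≤ f v)
  (f≤s : ∀ v → f v ≤ s)
  (f-growth : ∀ v → 0 < f v → f (v + t) < s → f v < f (v + t))
  (f-step : ∀ v → f (v + t) ≤ f v + 1)
  (f0 : f 0 ≡ 0) (f1 : 0 < f 1) (ft : f t ≤ 1)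
  where

  -- From `f 1` on, each step of `t` gains at least one until the value `s` is reached.
  f-lower : ∀ m → m < s → m < f (1 + m * t)
  f-lower zero    _ = f1
  f-lower (suc m) m<s with f (1 + m * t + t) <? s | f-lower m (<⇒≤ m<s)
  ... | yes f<s | IH = subst (λ z → suc m < f z) (cong suc (+-comm (m * t) t))
                         (≤-<-trans IH (f-growth (1 + m * t) (≤-<-trans z≤n IH) f<s))
  ... | no  f≮s | _  = subst (λ z → suc m < f z) (cong suc (+-comm (m * t) t))
                         (<-≤-trans m<s (≮⇒≥ f≮s))

  f-upper : ∀ m v → f (v + m * t) ≤ f v + m
  f-upper zero    v = ≤-reflexive (trans (cong f (+-identityʳ v)) (sym (+-identityʳ (f v))))
  f-upper (suc m) v = begin
    f (v + (t + m * t))  ≡⟨ cong f (lem v t (m * t)) ⟩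
    f (v + m * t + t)    ≤⟨ f-step (v + m * t) ⟩
    f (v + m * t) + 1    ≤⟨ +-monoˡ-≤ 1 (f-upper m v) ⟩
    f v + m + 1          ≡⟨ lem′ (f v) m ⟩
    f v + suc m          ∎
    where
    open ≤-Reasoning
    lem : ∀ a b c → a + (b + c) ≡ a + c + b
    lem = solve-∀
    lem′ : ∀ a m → a + m + 1 ≡ a + suc m
    lem′ = solve-∀

  -- Going back by steps of `t`, `c` gains at least one each time, unless a window is already full;
  -- fullness then persists downward by `c-anti`.
  c-lower : ∀ {k} j p → k < c (p + j * t) → k + suc j ≤ c p ⊎ s ≤ c p
  c-lower {k} zero p k<c = inj₁ (subst₂ _≤_ (sym (+-comm k 1)) (cong c (+-identityʳ p)) k<c)
  c-lower {k} (suc j) p k<c with c p <? s | c-lower j (p + t) (subst (λ z → k < c z) (sym (+-assoc p t _)) k<c)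
  ... | no  c≮s | _        = inj₂ (≮⇒≥ c≮s)
  ... | yes c<s | inj₂ s≤c = inj₂ (≤-trans s≤c (c-anti (m≤m+n p t)))
  ... | yes c<s | inj₁ k≤c = inj₁ (subst (_≤ c p) (sym (+-suc k (suc j)))
          (≤-<-trans k≤c (c-growth p (<-≤-trans (subst (0 <_) (sym (+-suc k j)) (s≤s z≤n)) k≤c) c<s)))

  -- Going forward, each step of `t` loses at least one as long as the window stays nonempty.
  c-upper-* : ∀ {k} p → k < s → c p ≤ k → ∀ j → 0 < c (p + j * t) → c (p + j * t) + j ≤ k
  c-upper-* {k} p k<s c≤k zero pos =
    subst (_≤ k) (sym (trans (+-identityʳ _) (cong c (+-identityʳ p)))) c≤k
  c-upper-* {k} p k<s c≤k (suc j) pos = begin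
    c (p + suc j * t) + suc j    ≡⟨ cong (λ z → c z + suc j) (lem p t (j * t)) ⟩
    c (p + j * t + t) + suc j    ≡⟨ +-suc _ j ⟩
    suc (c (p + j * t + t)) + j  ≤⟨ +-monoˡ-≤ j (c-growth (p + j * t) pos′ (≤-<-trans c≤k′ k<s)) ⟩
    c (p + j * t) + j            ≤⟨ c-upper-* p k<s c≤k j pos″ ⟩
    k                            ∎
    where
    open ≤-Reasoning
    lem : ∀ a b c → a + (b + c) ≡ a + c + b
    lem = solve-∀
    pos′ : 0 < c (p + j * t + t)
    pos′ = subst (λ z → 0 < c z) (lem p t (j * t)) pos
    pos″ : 0 < c (p + j * t)
    pos″ = <-≤-trans pos′ (c-anti (m≤m+n _ t))
    c≤k′ : c (p + j * t) ≤ k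
    c≤k′ = ≤-trans (c-anti (m≤m+n p (j * t))) c≤k

  c-upper : ∀ {k} p → k < s → c p ≤ k → ∀ d → 0 < c (p + d) → c (p + d) + d / t ≤ k
  c-upper p k<s c≤k d pos =
    ≤-trans (+-monoˡ-≤ (d / t) c≤) (c-upper-* p k<s c≤k (d / t) (<-≤-trans pos c≤))
    where
    c≤ : c (p + d) ≤ c (p + d / t * t)
    c≤ = c-anti (+-monoʳ-≤ p (subst (d / t * t ≤_) (sym (m≡m%n+[m/n]*n d t)) (m≤n+m _ (d % t))))

  -- With `k = c (x + t)`, `y` is the first place where `c` is at most `k`, and `1 + k * t` is the
  -- first where `f` exceeds `k`; `e = y + k * t` makes these two jumps coincide. Away from there a
  -- step of `t` changes `c` by at least one, until it is empty or full, and `f` by at most one.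
  -- Monotonicity absorbs the remainders modulo `t`.
  crossing : ∀ x → 0 < c (x + t) → c (x + t) < s →
             ∃ λ e → (∀ p v → p ≤ x + t → p + v ≡ e → f v ≤ c p) ×
                     (∀ p → x + t ≤ p → 0 < c p → ∃ λ v → p + v ≡ e × c p ≤ f v)
  crossing x pos k<s with descend c x t k<cx ≤-refl
    where
    k<cx : c (x + t) < c x
    k<cx with c x <? s
    ... | yes cx<s = c-growth x pos cx<s
    ... | no  cx≮s = <-≤-trans k<s (≮⇒≥ cx≮s)
  ... | δ , δ<t , k<c , c≤k = y + k * t , below , above
    where
    open ≤-Reasoning
    k = c (x + t)
    y = x + suc δ
    y≤X : y ≤ x + t
    y≤X = +-monoʳ-≤ x δ<t
    above : ∀ p → x + t ≤ p → 0 < c p → ∃ λ v → p + v ≡ y + k * t × c p ≤ f v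
    above p X≤p cp>0 with m≤n⇒∃[o]m+o≡n (≤-trans y≤X X≤p)
    ... | d , refl with m≤n⇒∃[o]m+o≡n (m%n<n d t) | m≤n⇒∃[o]m+o≡n j<k
      where
      j<k : d / t < k
      j<k = <-≤-trans (+-monoˡ-≤ (d / t) cp>0) (c-upper y k<s c≤k d cp>0)
    -- The required `v` is `k * t - d`. With `d = r + j * t` it equals `(t - r) + (k - j - 1) * t`,
    -- so `suc r′ = t - r` and `o = k - j - 1`.
    ...   | r′ , r+r′≡t | o , j+o≡k = suc r′ + o * t , sum≡ , (begin
        c (y + d)            ≤⟨ +-cancelʳ-≤ j _ _ (subst (c (y + d) + j ≤_) (trans (sym j+o≡k) (cong suc (+-comm j o))) (c-upper y k<s c≤k d cp>0)) ⟩
        suc o                ≤⟨ f-lower o (<-trans o<k k<s) ⟩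
        f (1 + o * t)        ≤⟨ f-mono (+-monoˡ-≤ (o * t) (s≤s z≤n)) ⟩
        f (suc r′ + o * t)   ∎)
      where
      j = d / t
      o<k : o < k
      o<k = subst (o <_) j+o≡k (s≤s (m≤n+m o j))
      lem : ∀ y r j t r′ o → y + (r + j * t) + (suc r′ + o * t) ≡ y + (suc r + r′ + (j + o) * t)
      lem = solve-∀
      sum≡ : y + d + (suc r′ + o * t) ≡ y + k * t
      sum≡ = begin-equality
        y + d + (suc r′ + o * t)                 ≡⟨ cong (λ z → y + z + (suc r′ + o * t)) (m≡m%n+[m/n]*n d t) ⟩
        y + (d % t + j * t) + (suc r′ + o * t)   ≡⟨ lem y (d % t) j t r′ o ⟩
        y + (suc (d % t) + r′ + (j + o) * t)     ≡⟨ cong (λ z → y + (z + (j + o) * t)) r+r′≡t ⟩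
        y + (suc (j + o)) * t                    ≡⟨ cong (λ z → y + z * t) j+o≡k ⟩
        y + k * t                                ∎
    below : ∀ p v → p ≤ x + t → p + v ≡ y + k * t → f v ≤ c p
    below p v p≤X p+v≡e with y ≤? p
    ... | yes y≤p = begin
      f v              ≤⟨ f-mono (+-cancelˡ-≤ p v (k * t) (≤-trans (≤-reflexive p+v≡e) (+-monoˡ-≤ (k * t) y≤p))) ⟩
      f (0 + k * t)    ≤⟨ f-upper k 0 ⟩
      f 0 + k          ≡⟨ cong (_+ k) f0 ⟩
      k                ≤⟨ c-anti p≤X ⟩
      c p              ∎
    -- Left of `y`, `d` is measured from `y - 1 = x + δ`, the last place where `c` exceeds `k`; that
    -- strict excess pays for `f (suc (d % t)) ≤ 1`.
    ... | no  y≰p with m≤n⇒∃[o]m+o≡n (s≤s⁻¹ (subst (p <_) (+-suc x δ) (≰⇒> y≰p)))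
    ...   | d , p+d≡ with c-lower {k} (d / t) (p + d % t) (subst (λ z → k < c z) x+δ≡ k<c)
      where
      x+δ≡ : x + δ ≡ p + d % t + d / t * t
      x+δ≡ = trans (sym p+d≡) (trans (cong (p +_) (m≡m%n+[m/n]*n d t)) (sym (+-assoc p _ _)))
    ...     | inj₂ s≤c = ≤-trans (f≤s v) (≤-trans s≤c (c-anti (m≤m+n p _)))
    ...     | inj₁ k≤c = begin
      f v                                   ≡⟨ cong f v≡ ⟩
      f (suc (d % t) + (d / t + k) * t)     ≤⟨ f-upper (d / t + k) _ ⟩
      f (suc (d % t)) + (d / t + k)         ≤⟨ +-monoˡ-≤ _ (≤-trans (f-mono (m%n<n d t)) ft) ⟩
      1 + (d / t + k)                       ≡⟨ trans (cong suc (+-comm (d / t) k)) (sym (+-suc k (d / t))) ⟩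
      k + suc (d / t)                       ≤⟨ k≤c ⟩
      c (p + d % t)                         ≤⟨ c-anti (m≤m+n p _) ⟩
      c p                                   ∎
      where
      lem : ∀ p r j t k → suc (p + (r + j * t)) + k * t ≡ p + (suc r + (j + k) * t)
      lem = solve-∀
      v≡ : v ≡ suc (d % t) + (d / t + k) * t
      v≡ = +-cancelˡ-≡ p v _ (begin-equality
        p + v                                   ≡⟨ p+v≡e ⟩
        x + suc δ + k * t                       ≡⟨ cong (_+ k * t) (+-suc x δ) ⟩
        suc (x + δ) + k * t                     ≡⟨ cong (λ z → suc z + k * t) p+d≡ ⟨
        suc (p + d) + k * t                     ≡⟨ cong (λ z → suc (p + z) + k * t) (m≡m%n+[m/n]*n d t) ⟩
        suc (p + (d % t + d / t * t)) + k * t   ≡⟨ lem p (d % t) (d / t) t k ⟩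
        p + (suc (d % t) + (d / t + k) * t)     ∎)

-- The semigroup `W` and its window counts.

module Semigroup (s t : ℕ) (0<s : 0 < s) (s<t : s < t) (coprime : Coprime s t) where

  instance
    s≢0 : NonZero s
    s≢0 = >-nonZero 0<s
    t≢0 : NonZero t
    t≢0 = >-nonZero (<-trans 0<s s<t)

  W : ℕ → Set
  W w = ∃ λ a → ∃ λ b → w ≡ a * s + b * t

  abstract
    W? : Decidable W
    W? w = map′
      (λ { (a , _ , b , _ , eq) → a , b , eq })
      (λ { (a , b , refl) → a , s≤s (≤-trans (m≤m*n a s) (m≤m+n (a * s) (b * t)))
                          , b , s≤s (≤-trans (m≤m*n b t) (m≤n+m (b * t) (a * s))) , refl })
      (anyUpTo? (λ a → anyUpTo? (λ b → w ≟ a * s + b * t) (suc w)) (suc w))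

  0∈W : W 0
  0∈W = 0 , 0 , refl

  s∈W : W s
  s∈W = 1 , 0 , sym (trans (+-identityʳ _) (+-identityʳ s))

  t∈W : W t
  t∈W = 0 , 1 , sym (+-identityʳ t)

  W-+ : ∀ {v w} → W v → W w → W (v + w)
  W-+ (a , b , refl) (a′ , b′ , refl) = a + a′ , b + b′ , lem a b a′ b′ s t
    where
    lem : ∀ a b a′ b′ s t → a * s + b * t + (a′ * s + b′ * t) ≡ (a + a′) * s + (b + b′) * t
    lem = solve-∀

  V : ℕ → ℕ
  V = count W?

  W⁺ : ℕ → Set
  W⁺ z = s ≤ z × W (z ∸ s)

  W⁺? : Decidable W⁺
  W⁺? z = (s ≤? z) ×-dec W? (z ∸ s)

  W⁺-+ : ∀ {z w} → W w → W⁺ z → W⁺ (z + w)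
  W⁺-+ {z} {w} Ww (s≤z , Wz) = ≤-trans s≤z (m≤m+n z w) , subst W (sym (+-∸-comm w s≤z)) (W-+ Wz Ww)

  -- Split on the coefficient of `t`: zero leaves a multiple of `s`, a positive one can give up one
  -- `t`.
  W⁺-split : ∀ {z} → W⁺ z → s ∣ z ⊎ ∃ λ y → z ≡ y + t × W⁺ y
  W⁺-split {z} (s≤z , a , zero , eq) = inj₁ (divides (suc a) (begin
    z                ≡⟨ m+[n∸m]≡n s≤z ⟨
    s + (z ∸ s)      ≡⟨ cong (s +_) (trans eq (+-identityʳ (a * s))) ⟩
    s + a * s        ∎))
    where open ≡-Reasoning
  W⁺-split {z} (s≤z , a , suc b , eq) =
    inj₂ (s + (a * s + b * t) , z≡ , m≤m+n s _ , a , b , m+n∸m≡n s _)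
    where
    open ≡-Reasoning
    lem : ∀ s a b t → s + (a * s + (t + b * t)) ≡ s + (a * s + b * t) + t
    lem = solve-∀
    z≡ : z ≡ s + (a * s + b * t) + t
    z≡ = begin
      z                              ≡⟨ m+[n∸m]≡n s≤z ⟨
      s + (z ∸ s)                    ≡⟨ cong (s +_) eq ⟩
      s + (a * s + (t + b * t))      ≡⟨ lem s a b t ⟩
      s + (a * s + b * t) + t        ∎

  -- f v counts the elements of W in [v - s, v): W⁺ is W + s, which keeps indices natural.
  f : ℕ → ℕ
  f = window W⁺? s

  count-W⁺-s : count W⁺? s ≡ 0
  count-W⁺-s = count-empty W⁺? s (λ j<s W⁺j → <⇒≱ j<s (proj₁ W⁺j))

  count-W⁺ : ∀ v → count W⁺? (v + s) ≡ V v
  count-W⁺ v = begin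
    count W⁺? (v + s)                                     ≡⟨ cong (count W⁺?) (+-comm v s) ⟩
    count W⁺? (s + v)                                     ≡⟨ count-+ W⁺? s v ⟩
    count W⁺? s + count (λ j → W⁺? (s + j)) v             ≡⟨ cong₂ _+_ count-W⁺-s (count-cong _ W? v (λ {j} _ → mk⇔
                                                              (λ W⁺j → subst W (m+n∸m≡n s j) (proj₂ W⁺j))
                                                              (λ Wj → m≤m+n s j , subst W (sym (m+n∸m≡n s j)) Wj))) ⟩
    V v                                                   ∎
    where open ≡-Reasoning

  V-+s : ∀ v → V (v + s) ≡ V v + f (v + s)
  V-+s v = begin
    V (v + s)                               ≡⟨ count-W⁺ (v + s) ⟨
    count W⁺? (v + s + s)                   ≡⟨ count-+ W⁺? (v + s) s ⟩
    count W⁺? (v + s) + f (v + s)           ≡⟨ cong (_+ f (v + s)) (count-W⁺ v) ⟩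
    V v + f (v + s)                         ∎
    where open ≡-Reasoning

  f≤V : ∀ v → f v ≤ V v
  f≤V v = begin
    f v                     ≤⟨ m≤n+m (f v) (count W⁺? v) ⟩
    count W⁺? v + f v       ≡⟨ count-+ W⁺? v s ⟨
    count W⁺? (v + s)       ≡⟨ count-W⁺ v ⟩
    V v                     ∎
    where open ≤-Reasoning

  f≤s : ∀ v → f v ≤ s
  f≤s v = count≤ _ s

  f0 : f 0 ≡ 0
  f0 = count-W⁺-s

  f1 : 0 < f 1
  f1 = ≤-reflexive (begin
    1                       ≡⟨ cong (_+ 0) (indicator-yes (W? 0) 0∈W) ⟨
    V 1                     ≡⟨ count-W⁺ 1 ⟨
    count W⁺? (1 + s)       ≡⟨ count-+ W⁺? 1 s ⟩
    count W⁺? 1 + f 1       ≡⟨ cong (_+ f 1) (n≤0⇒n≡0 (subst (count W⁺? 1 ≤_) count-W⁺-s (count-mono W⁺? 0<s))) ⟩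
    f 1                     ∎)
    where open ≡-Reasoning

  -- The complement of W⁺ is closed under subtraction of s and t, so its windows
  -- satisfy the same laws as those of a closed beta-set.
  W⁻? : Decidable (¬_ ∘ W⁺)
  W⁻? z = ¬? (W⁺? z)

  f-complement : ∀ v → f v + window W⁻? s v ≡ s
  f-complement v = count-∁ (λ j → W⁺? (v + j)) s

  complement-< : ∀ {a b a′ b′} → a + b ≡ a′ + b′ → b′ < b → a < a′
  complement-< {a} {b} {a′} {b′} eq b′<b with a <? a′
  ... | yes a<a′ = a<a′
  ... | no  a≮a′ = contradiction (sym eq) (<⇒≢ (+-mono-≤-< (≮⇒≥ a≮a′) b′<b))

  complement-≤ : ∀ {a b a′ b′} → a + b ≡ a′ + b′ → b′ ≤ b → a ≤ a′
  complement-≤ {a} {b} {a′} {b′} eq b′≤b with a ≤? a′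
  ... | yes a≤a′ = a≤a′
  ... | no  a≰a′ = contradiction (sym eq) (<⇒≢ (+-mono-<-≤ (≰⇒> a≰a′) b′≤b))

  f-mono : ∀ {u v} → u ≤ v → f u ≤ f v
  f-mono {u} {v} u≤v = complement-≤ (trans (f-complement u) (sym (f-complement v)))
    (window-antitone W⁻? s (_∘ W⁺-+ s∈W) u≤v)

  -- Passing to the complement exchanges nonempty with not full, and loss with gain.
  f-growth : ∀ v → 0 < f v → f (v + t) < s → f v < f (v + t)
  f-growth v f>0 f<s = complement-< (trans (f-complement v) (sym (f-complement (v + t))))
    (window-growth s t coprime W⁻? (_∘ W⁺-+ s∈W) (_∘ W⁺-+ t∈W) v
      (complement-< (trans (sym (f-complement (v + t))) (+-comm (f (v + t)) _)) f<s)
      (complement-< (trans (+-comm _ (f v)) (trans (f-complement v) (sym (+-identityʳ s)))) f>0))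

  -- Multiples of `s` are closed under subtracting `s`, so no window holds more of them than the one
  -- at 0, where only 0 qualifies.
  multiples≤1 : ∀ v → window (s ∣?_) s v ≤ 1
  multiples≤1 v = ≤-trans
    (window-antitone (s ∣?_) s (λ {z} s∣z+s → ∣m+n∣m⇒∣n (subst (s ∣_) (+-comm z s) s∣z+s) ∣-refl) {q = v} z≤n)
    (at-0 s refl)
    where
    at-0 : ∀ r → r ≡ s → count (s ∣?_) r ≤ 1
    at-0 zero    _    = z≤n
    at-0 (suc r) refl rewrite count-+ (s ∣?_) 1 r
                            | count-empty (λ j → s ∣? suc j) r (λ j<r → >⇒∤ (s≤s j<r)) =
      subst (_≤ 1) (sym (trans (+-identityʳ _) (+-identityʳ _))) (indicator≤1 (s ∣? 0))

  -- By `W⁺-split`, what does not come from the window at `v` by adding `t` is a multiple of `s`,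
  -- and a window has at most one of those.
  f-step : ∀ v → f (v + t) ≤ f v + 1
  f-step v = ≤-trans
    (count-∪ (λ j → W⁺? (v + t + j)) (λ j → W⁺? (v + j)) (λ j → s ∣? (v + t + j)) s (λ _ → cases))
    (+-monoʳ-≤ (f v) (multiples≤1 (v + t)))
    where
    swap : ∀ v t j → v + t + j ≡ v + j + t
    swap = solve-∀
    cases : ∀ {j} → W⁺ (v + t + j) → W⁺ (v + j) ⊎ s ∣ v + t + j
    cases {j} W⁺z with W⁺-split W⁺z
    ... | inj₁ s∣z           = inj₂ s∣z
    ... | inj₂ (y , eq , W⁺y) = inj₁ (subst W⁺ (+-cancelʳ-≡ t y (v + j) (trans (sym eq) (swap v t j))) W⁺y)

  -- Removing `t` from a position below `t + s` lands below `s`, where `W⁺` is empty; only a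
  -- multiple of `s` can remain.
  ft : f t ≤ 1
  ft = ≤-trans (count-⊆ (λ j → W⁺? (t + j)) (λ j → s ∣? (t + j)) s cases) (multiples≤1 t)
    where
    cases : ∀ {j} → j < s → W⁺ (t + j) → s ∣ t + j
    cases {j} j<s W⁺z with W⁺-split W⁺z
    ... | inj₁ s∣z = s∣z
    ... | inj₂ (y , eq , s≤y , _) =
      contradiction (subst (s ≤_) (+-cancelʳ-≡ t y j (trans (sym eq) (+-comm t j))) s≤y) (<⇒≱ j<s)

  V-unbounded : ∀ i → i ≤ V (1 + i * s)
  V-unbounded zero = z≤n
  V-unbounded (suc i) = begin
    suc i                                 ≡⟨ +-comm 1 i ⟩
    i + 1                                 ≤⟨ +-mono-≤ (V-unbounded i) (≤-trans f1 (f-mono (s≤s z≤n))) ⟩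
    V (1 + i * s) + f (1 + i * s + s)     ≡⟨ V-+s (1 + i * s) ⟨
    V (1 + i * s + s)                     ≡⟨ cong (V ∘ suc) (+-comm (i * s) s) ⟩
    V (1 + suc i * s)                     ∎
    where open ≤-Reasoning

  -- Summing windows of a closed set against those of `W`.

  module Closed {B : ℕ → Set} (B? : Decidable B)
                (B-s : ∀ {z} → B (z + s) → B z) (B-t : ∀ {z} → B (z + t) → B z)
                (T : ℕ) where

    N : ℕ
    N = count B? T

    c : ℕ → ℕ
    c = window B? s

    c-anti : ∀ {p q} → p ≤ q → c q ≤ c p
    c-anti = window-antitone B? s B-s

    open Crossing s t c f c-anti (window-growth s t coprime B? B-s B-t)
      f-mono f≤s f-growth f-step f0 f1 ft

    -- After an empty window all later ones are empty, and `T` further windows reach past `T`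
    -- because `s` is positive.
    exhausted : ∀ p → c p ≡ 0 → N ≤ count B? p
    exhausted p cp≡0 = begin
      count B? T                ≤⟨ count-mono B? (≤-trans (m≤m*n T s) (m≤n+m (T * s) p)) ⟩
      count B? (p + T * s)      ≤⟨ constant T ⟩
      count B? p                ∎
      where
      open ≤-Reasoning
      lem : ∀ p a s → p + (s + a * s) ≡ p + a * s + s
      lem = solve-∀
      constant : ∀ a → count B? (p + a * s) ≤ count B? p
      constant zero    = ≤-reflexive (cong (count B?) (+-identityʳ p))
      constant (suc a) = begin
        count B? (p + (s + a * s))              ≡⟨ cong (count B?) (lem p a s) ⟩
        count B? (p + a * s + s)                ≡⟨ count-+ B? (p + a * s) s ⟩
        count B? (p + a * s) + c (p + a * s)    ≤⟨ +-mono-≤ (constant a) (≤-trans (c-anti (m≤m+n p (a * s))) (≤-reflexive cp≡0)) ⟩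
        count B? p + 0                          ≡⟨ +-identityʳ _ ⟩
        count B? p                              ∎

    -- Windows at `p`, `p + s`, ... are matched with those at `v`, `v - s`, ... . Once `v < s`, a
    -- nonempty window at `p + s` would need a negative partner, so only `c p ≤ f v ≤ V v` is left.
    -- `fuel` bounds `v` for termination.
    above-≤ : ∀ {X e} → (∀ p → X ≤ p → 0 < c p → ∃ λ v → p + v ≡ e × c p ≤ f v) →
              ∀ fuel p v → v < fuel → X ≤ p → p + v ≡ e → N ≤ count B? p + V v
    above-≤ {X} {e} above (suc fuel) p v v<fuel X≤p p+v≡e with c p ≟ 0 | v <? s
    ... | yes cp≡0 | _ = ≤-trans (exhausted p cp≡0) (m≤m+n _ (V v))
    ... | no  cp≢0 | yes v<s = begin
      N                              ≤⟨ exhausted (p + s) (n≤0⇒n≡0 (≮⇒≥ beyond)) ⟩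
      count B? (p + s)               ≡⟨ count-+ B? p s ⟩
      count B? p + c p               ≤⟨ +-monoʳ-≤ (count B? p) (≤-trans cp≤fv (f≤V v)) ⟩
      count B? p + V v               ∎
      where
      open ≤-Reasoning
      cp≤fv : c p ≤ f v
      cp≤fv with above p X≤p (n≢0⇒n>0 cp≢0)
      ... | v′ , eq , cp≤fv′ = subst (λ z → c p ≤ f z) (+-cancelˡ-≡ p v′ v (trans eq (sym p+v≡e))) cp≤fv′
      beyond : ¬ (0 < c (p + s))
      beyond pos with above (p + s) (≤-trans X≤p (m≤m+n p s)) pos
      ... | v′ , eq , _ = <⇒≱ v<s (≤-trans (m≤m+n s v′)
                            (≤-reflexive (+-cancelˡ-≡ p (s + v′) v (trans (sym (+-assoc p s v′)) (trans eq (sym p+v≡e))))))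
    ... | no  cp≢0 | no v≮s with v ∸ s | m∸n+n≡m (≮⇒≥ v≮s)
    ...   | o | refl = begin
      N                                     ≤⟨ above-≤ above fuel (p + s) o (≤-trans (m<m+n o 0<s) (s≤s⁻¹ v<fuel)) (≤-trans X≤p (m≤m+n p s)) (trans (lem p s o) p+v≡e) ⟩
      count B? (p + s) + V o                ≡⟨ cong (_+ V o) (count-+ B? p s) ⟩
      count B? p + c p + V o                ≤⟨ +-monoˡ-≤ (V o) (+-monoʳ-≤ (count B? p) cp≤fv) ⟩
      count B? p + f (o + s) + V o          ≡⟨ lem′ (count B? p) _ _ ⟩
      count B? p + (V o + f (o + s))        ≡⟨ cong (count B? p +_) (V-+s o) ⟨
      count B? p + V (o + s)                ∎
      where
      open ≤-Reasoning
      lem : ∀ p s o → p + s + o ≡ p + (o + s)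
      lem = solve-∀
      lem′ : ∀ a b c → a + b + c ≡ a + (c + b)
      lem′ = solve-∀
      cp≤fv : c p ≤ f (o + s)
      cp≤fv with above p X≤p (n≢0⇒n>0 cp≢0)
      ... | v′ , eq , cp≤fv′ = subst (λ z → c p ≤ f z) (+-cancelˡ-≡ p v′ (o + s) (trans eq (sym p+v≡e))) cp≤fv′

    window>0 : ∀ p {i} → 0 < i → count B? p + i ≡ N → 0 < c p
    window>0 p 0<i b+i≡N = n≢0⇒n>0 λ c≡0 →
      <⇒≱ (m<m+n (count B? p) 0<i) (≤-trans (≤-reflexive b+i≡N) (exhausted p c≡0))

    pivot : ∀ x {i} → 0 < i → count B? (x + t) + i ≡ N →
            ∃ λ u → V u ≡ i × (∀ p v → p + v ≡ x + t → f (u + v) ≤ c p)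
    pivot x {i} 0<i b+i≡N = by-cases (c (x + t) <? s)
      where
      by-cases : Dec (c (x + t) < s) → ∃ λ u → V u ≡ i × (∀ p v → p + v ≡ x + t → f (u + v) ≤ c p)
      -- A full window at `x + t` makes all lower ones full, so `f ≤ s` suffices and any `u` with
      -- `V u ≡ i` serves.
      by-cases (no c≮s) =
        let u , _ , Vu≡i = count-reaches W? (1 + i * s) (V-unbounded i)
        in u , Vu≡i , λ p v p+v≡X →
          ≤-trans (f≤s (u + v)) (≤-trans (≮⇒≥ c≮s) (c-anti (m+n≤o⇒m≤o p (≤-reflexive p+v≡X))))
      -- The partner `v₀` of `x + t` has `V v₀` at least `i`. Replacing it by a smaller `u` only
      -- lowers `f`, so the domination below `x + t` survives.
      by-cases (yes c<s) =
        let c>0 = window>0 (x + t) 0<i b+i≡N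
            e , below , above = crossing x c>0 c<s
            v₀ , X+v₀≡e , _ = above (x + t) ≤-refl c>0
            i≤Vv₀ = +-cancelˡ-≤ (count B? (x + t)) i (V v₀)
              (≤-trans (≤-reflexive b+i≡N) (above-≤ above (suc v₀) (x + t) v₀ ≤-refl ≤-refl X+v₀≡e))
            u , u≤v₀ , Vu≡i = count-reaches W? v₀ i≤Vv₀
        in u , Vu≡i , λ p v p+v≡X → ≤-trans
          (f-mono (subst (_≤ v + v₀) (+-comm v u) (+-monoʳ-≤ v u≤v₀)))
          (below p (v + v₀) (m+n≤o⇒m≤o p (≤-reflexive p+v≡X))
            (trans (sym (+-assoc p v v₀)) (trans (cong (_+ v₀) p+v≡X) X+v₀≡e)))

    -- Each window removed from `B` below `X` holds at least as much as the window of `W` added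
    -- above `u`.
    windows-≤ : ∀ {X u} → count B? X + V u ≡ N → (∀ p v → p + v ≡ X → f (u + v) ≤ c p) →
                ∀ a p → p + a * s ≡ X → count B? p + V (u + a * s) ≤ N
    windows-≤ {X} {u} b+V≡N f≤c zero p p≡X = ≤-reflexive (trans
      (cong₂ (λ p′ u′ → count B? p′ + V u′) (trans (sym (+-identityʳ p)) p≡X) (+-identityʳ u)) b+V≡N)
    windows-≤ {X} {u} b+V≡N f≤c (suc a) p eq = begin
      count B? p + V (u + (s + a * s))                           ≡⟨ cong (λ z → count B? p + V z) (lem u s (a * s)) ⟩
      count B? p + V (u + a * s + s)                             ≡⟨ cong (count B? p +_) (V-+s (u + a * s)) ⟩
      count B? p + (V (u + a * s) + f (u + a * s + s))           ≡⟨ lem′ (count B? p) _ _ ⟩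
      count B? p + f (u + a * s + s) + V (u + a * s)             ≤⟨ +-monoˡ-≤ _ (+-monoʳ-≤ (count B? p) (subst (λ z → f z ≤ c p) (lem u s (a * s)) (f≤c p (s + a * s) eq))) ⟩
      count B? p + c p + V (u + a * s)                           ≡⟨ cong (_+ V (u + a * s)) (count-+ B? p s) ⟨
      count B? (p + s) + V (u + a * s)                           ≤⟨ windows-≤ b+V≡N f≤c a (p + s) (trans (+-assoc p s _) eq) ⟩
      N                                                          ∎
      where
      open ≤-Reasoning
      lem : ∀ u s z → u + (s + z) ≡ u + z + s
      lem = solve-∀
      lem′ : ∀ a b c → a + (b + c) ≡ a + c + b
      lem′ = solve-∀

  -- Delta-sets and the maximal one.

  δ? : ∀ g → Decidable (λ z → W (g ∸ suc z))
  -- For `z ≥ g` truncation yields 0, which lies in `W`; the predicate means membership only below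
  -- `g`, where `delta` cuts it off.
  δ? g z = W? (g ∸ suc z)

  delta : ℕ → List ℕ
  delta g = enumerate (δ? g) g

  ∈-delta⁺ : ∀ {g w} → W w → w < g → g ∸ w ∈ delta g
  ∈-delta⁺ {g} {w} Ww w<g with m≤n⇒∃[o]m+o≡n w<g
  ... | z , refl = subst (_∈ delta g) (sym g∸w) (∈-enumerate⁺ (δ? g) g (s≤s (m≤n+m z w))
                     (subst W (sym (m+n∸n≡m w z)) Ww))
    where
    g∸w : suc (w + z) ∸ w ≡ suc z
    g∸w = trans (cong (_∸ w) (sym (+-suc w z))) (m+n∸m≡n w (suc z))

  ∈-delta⁻ : ∀ g {y} → y ∈ delta g → ∃ λ w → W w × w < g × y ≡ g ∸ w
  ∈-delta⁻ g y∈ with ∈-enumerate⁻ (δ? g) g y∈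
  ... | z , refl , z<g , Wz = g ∸ suc z , Wz , ∸-monoʳ-< (s≤s z≤n) z<g , sym (m∸[m∸n]≡n z<g)

  δ-reflect : ∀ g p v → p + v ≡ g → count (δ? g) p + V v ≡ V g
  δ-reflect g = count-reflect (δ? g) W? g λ {a} {b} eq → mk⇔
    (subst W (trans (cong (_∸ suc a) (sym eq)) (m+n∸m≡n (suc a) b)))
    (subst W (sym (trans (cong (_∸ suc a) (sym eq)) (m+n∸m≡n (suc a) b))))

  count-δ : ∀ g → count (δ? g) g ≡ V g
  count-δ g = trans (sym (+-identityʳ _)) (δ-reflect g g 0 (+-identityʳ g))

  length-delta : ∀ g → length (delta g) ≡ V g
  length-delta g = trans (length-enumerate (δ? g) g) (count-δ g)

  delta-represents : ∀ g → Represents (delta g) (closure s t (g ∷ []))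
  delta-represents g = enumerate-isBetaSet (δ? g) g , λ y → mk⇔ to from
    where
    to : ∀ {y} → y ∈ delta g → closure s t (g ∷ []) y
    to y∈ with ∈-delta⁻ g y∈
    ... | _ , (a , b , refl) , w<g , y≡ = g , a , b , here refl , w<g , y≡
    from : ∀ {y} → closure s t (g ∷ []) y → y ∈ delta g
    from (_ , a , b , here refl , w<g , refl) = ∈-delta⁺ (a , b , refl) w<g

  represented-unique : ∀ {β γ S} → Represents β S → Represents γ S → β ≡ γ
  represented-unique (β-set , β⇔) (γ-set , γ⇔) = betaSet-unique β-set γ-set
    (λ {x} → Equivalence.from (γ⇔ x) ∘ Equivalence.to (β⇔ x))
    (λ {x} → Equivalence.from (β⇔ x) ∘ Equivalence.to (γ⇔ x))

  -- The generator `g` shifts to `g + s`, which yields all of `delta (g + s)`; conversely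
  -- `(g - w) + s - e = (g + s) - (w + e)` and `w + e` stays in `W`.
  delta-shift-represents : ∀ g → 0 < g → Represents (delta (g + s)) (closure s t (delta g +ₛ s))
  delta-shift-represents g 0<g = enumerate-isBetaSet (δ? (g + s)) (g + s) , λ y → mk⇔ to from
    where
    to : ∀ {y} → y ∈ delta (g + s) → closure s t (delta g +ₛ s) y
    to y∈ with ∈-delta⁻ (g + s) y∈
    ... | _ , (a , b , refl) , w<g+s , y≡ = g + s , a , b , ∈-map⁺ (_+ s) (∈-delta⁺ 0∈W 0<g) , w<g+s , y≡
    from : ∀ {y} → closure s t (delta g +ₛ s) y → y ∈ delta (g + s)
    from (_ , a , b , x∈ , e<x , refl) with ∈-map⁻ (_+ s) x∈
    ... | _ , x′∈ , refl with ∈-delta⁻ g x′∈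
    ...   | w , Ww , w<g , refl =
      subst (_∈ delta (g + s)) y≡ (∈-delta⁺ (W-+ Ww (a , b , refl)) w+e<g+s)
      where
      e = a * s + b * t
      y≡ : g + s ∸ (w + e) ≡ g ∸ w + s ∸ e
      y≡ = trans (sym (∸-+-assoc (g + s) w e)) (cong (_∸ e) (+-∸-comm s (<⇒≤ w<g)))
      w+e<g+s : w + e < g + s
      w+e<g+s = subst (w + e <_) (trans (sym (+-assoc w (g ∸ w) s)) (cong (_+ s) (m+[n∸m]≡n (<⇒≤ w<g))))
                  (+-monoʳ-< w e<x)

  -- Both lists start with their generator and have tails of equal length, so the first part grows
  -- by one.
  delta-suc-⊀ : ∀ g → 0 < g → length (delta (suc g)) ≡ length (delta g) → ¬ (delta (suc g) ≺ delta g)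
  delta-suc-⊀ (suc g) _ len≡ ≺
    rewrite enumerate-∷ (δ? (2 + g)) (suc g) (subst W (sym (n∸n≡0 g)) 0∈W)
          | enumerate-∷ (δ? (1 + g)) g (subst W (sym (n∸n≡0 g)) 0∈W)
    with ≺
  ... | ∷<P head≤ _ = <⇒≱ (∸-monoˡ-< ≤-refl len≤)
                          (subst (λ l → 2 + g ∸ l ≤ 1 + g ∸ length (enumerate (δ? (1 + g)) g)) (suc-injective len≡) head≤)
    where
    -- This bound keeps truncated subtraction strictly monotone here.
    len≤ : length (enumerate (δ? (1 + g)) g) ≤ suc g
    len≤ = m≤n⇒m≤1+n (≤-trans (≤-reflexive (length-enumerate (δ? (1 + g)) g)) (count≤ (δ? (1 + g)) g))

  -- If `g` were outside `W`, then `V (suc g)` would equal `V g`, and `delta (suc g)` would be a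
  -- delta-set of the same size not below `D`.
  maximal-delta : ∀ {n D} → IsMaxDelta s t n D →
                  ∃ λ g → 0 < g × D ≡ delta g × W g × V g ≡ n
  maximal-delta ((g , 0<g , D-rep) , len , maximal)
    with represented-unique D-rep (delta-represents g)
  ... | refl with W? g
  ...   | yes Wg = g , 0<g , refl , Wg , trans (sym (length-delta g)) len
  ...   | no ¬Wg = contradiction (maximal (delta (suc g)) (suc g , s≤s z≤n , delta-represents (suc g)) (trans len≡ len))
                                 (delta-suc-⊀ g 0<g len≡)
    where
    len≡ : length (delta (suc g)) ≡ length (delta g)
    len≡ = begin
      length (delta (suc g))         ≡⟨ length-delta (suc g) ⟩
      indicator (W? g) + V g         ≡⟨ cong (_+ V g) (indicator-no (W? g) ¬Wg) ⟩
      V g                            ≡⟨ length-delta g ⟨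
      length (delta g)               ∎
      where open ≡-Reasoning

  -- The bound for each element of a closed beta-set.

  module _ (P? : Decidable P) (P-s : ∀ {z} → P (z + s) → P z) (P-t : ∀ {z} → P (z + t) → P z) (M : ℕ) where

    -- P + t together with all of [0, t): nonpositive positions count as occupied, and
    -- the shift by t keeps them natural.
    B : ℕ → Set
    B z = z < t ⊎ t ≤ z × P (z ∸ t)

    B? : Decidable B
    B? z = (z <? t) ⊎-dec ((t ≤? z) ×-dec P? (z ∸ t))

    B-closed : ∀ o → (∀ {z} → P (z + o) → P z) → ∀ {z} → B (z + o) → B z
    B-closed o P-o {z} Bz with z <? t | Bz
    ... | yes z<t | _                = inj₁ z<t
    ... | no  z≮t | inj₁ z+o<t       = contradiction (≤-<-trans (m≤m+n z o) z+o<t) z≮t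
    ... | no  z≮t | inj₂ (_ , Pz+o∸t) = inj₂ (≮⇒≥ z≮t , P-o (subst P (+-∸-comm o (≮⇒≥ z≮t)) Pz+o∸t))

    count-B-below : ∀ {p} → p ≤ t → count B? p ≡ p
    count-B-below {p} p≤t = count-full B? p (λ j<p → inj₁ (<-≤-trans j<p p≤t))

    count-B : ∀ l → count B? (t + l) ≡ t + count P? l
    count-B l = trans (count-+ B? t l) (cong₂ _+_ (count-B-below ≤-refl) (count-cong _ P? l (λ {j} _ → mk⇔ to from)))
      where
      to : ∀ {j} → B (t + j) → P j
      to {j} (inj₁ t+j<t) = contradiction t+j<t (m+n≮m t j)
      to {j} (inj₂ (_ , Pj)) = subst P (m+n∸m≡n t j) Pj
      from : ∀ {j} → P j → B (t + j)
      from {j} Pj = inj₂ (m≤m+n t j , subst P (sym (m+n∸m≡n t j)) Pj)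

    open Closed B? (B-closed s P-s) (B-closed t P-t) (t + M)

    -- With `r` and `q` the remainder and quotient of `z` by `s` and `y = u + q * s`, removing `q`
    -- windows gives `V y ≤ n`, and one more gives `r + V (y + s) ≤ n + s`. From `y + s` to `g + s`,
    -- `V` gains at most `g - y`, which yields the bound.
    room : ∀ {n g K u z} → count P? M ≡ n → V g ≡ n → W g → V (g + s) ≡ K + n →
           count B? (z + t) + V u ≡ N → (∀ p v → p + v ≡ z + t → f (u + v) ≤ c p) →
           z + K + u ≤ g + s
    room {n} {g} {K} {u} {z} count≡n Vg≡n Wg Vg+s b+V≡N f≤c with m≤n⇒∃[o]m+o≡n y≤g
      where
      open ≤-Reasoning
      y = u + z / s * s
      N≡ : N ≡ t + n
      N≡ = trans (count-B M) (cong (t +_) count≡n)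
      lem : ∀ t r qs → t + r + qs ≡ (r + qs) + t
      lem = solve-∀
      Vy≤n : V y ≤ n
      Vy≤n = +-cancelˡ-≤ t _ _ (begin
        t + V y                            ≤⟨ +-monoˡ-≤ (V y) (m≤m+n t _) ⟩
        t + count P? (z % s) + V y         ≡⟨ cong (_+ V y) (count-B (z % s)) ⟨
        count B? (t + z % s) + V y         ≤⟨ windows-≤ b+V≡N f≤c (z / s) (t + z % s) (trans (lem t (z % s) _) (cong (_+ t) (sym (m≡m%n+[m/n]*n z s)))) ⟩
        N                                  ≡⟨ N≡ ⟩
        t + n                              ∎)
      -- Membership of `g` in `W` makes `V` jump just after `g`, so `V y ≤ V g` forces `y ≤ g`.
      y≤g : y ≤ g
      y≤g = s≤s⁻¹ (count-cancel-< W? (begin-strict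
        V y                      ≤⟨ Vy≤n ⟩
        n                        ≡⟨ Vg≡n ⟨
        V g                      <⟨ n<1+n (V g) ⟩
        1 + V g                  ≡⟨ cong (_+ V g) (indicator-yes (W? g) Wg) ⟨
        V (suc g)                ∎))
    ... | d , y+d≡g = +-cancelˡ-≤ n _ _ (begin
      n + (z + K + u)                                ≡⟨ cong (λ x → n + (x + K + u)) (m≡m%n+[m/n]*n z s) ⟩
      n + (z % s + z / s * s + K + u)                ≡⟨ lem₁ n (z % s) (z / s * s) K u ⟩
      (K + n) + (z % s + y)                          ≡⟨ cong (_+ (z % s + y)) Vg+s ⟨
      V (g + s) + (z % s + y)                        ≡⟨ cong (λ x → V x + (z % s + y)) (trans (cong (_+ s) (sym y+d≡g)) (lem₂ y d s)) ⟩
      V (y + s + d) + (z % s + y)                    ≤⟨ +-monoˡ-≤ (z % s + y) (count-+-≤ W? (y + s) d) ⟩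
      V (y + s) + d + (z % s + y)                    ≡⟨ lem₃ (V (y + s)) d (z % s) y ⟩
      (z % s + V (y + s)) + (y + d)                  ≤⟨ +-monoˡ-≤ (y + d) ρ+V≤n+s ⟩
      (n + s) + (y + d)                              ≡⟨ cong ((n + s) +_) y+d≡g ⟩
      (n + s) + g                                    ≡⟨ lem₄ n s g ⟩
      n + (g + s)                                    ∎)
      where
      open ≤-Reasoning
      y = u + z / s * s
      -- The extra window ends at `l`, in the fully occupied stretch below `t`, so the count of `B`
      -- there is exactly `l`; `s < t` keeps `l` natural.
      l = t ∸ s + z % s
      l≤t : l ≤ t
      l≤t = subst (l ≤_) (m∸n+n≡m (<⇒≤ s<t)) (+-monoʳ-≤ (t ∸ s) (<⇒≤ (m%n<n z s)))
      lem₁ : ∀ n r qs K u → n + (r + qs + K + u) ≡ (K + n) + (r + (u + qs))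
      lem₁ = solve-∀
      lem₂ : ∀ y d s → y + d + s ≡ y + s + d
      lem₂ = solve-∀
      lem₃ : ∀ v d r y → v + d + (r + y) ≡ (r + v) + (y + d)
      lem₃ = solve-∀
      lem₄ : ∀ n s g → n + s + g ≡ n + (g + s)
      lem₄ = solve-∀
      lem₅ : ∀ a r s qs → a + r + (s + qs) ≡ (r + qs) + (a + s)
      lem₅ = solve-∀
      lem₆ : ∀ a s r v → (a + s) + (r + v) ≡ (a + r + v) + s
      lem₆ = solve-∀
      lem₇ : ∀ u s qs → u + (s + qs) ≡ u + qs + s
      lem₇ = solve-∀
      l+[1+q]s≡z+t : l + suc (z / s) * s ≡ z + t
      l+[1+q]s≡z+t = trans (lem₅ (t ∸ s) (z % s) s _)
        (cong₂ _+_ (sym (m≡m%n+[m/n]*n z s)) (m∸n+n≡m (<⇒≤ s<t)))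
      ρ+V≤n+s : z % s + V (y + s) ≤ n + s
      ρ+V≤n+s = +-cancelˡ-≤ t _ _ (begin
        t + (z % s + V (y + s))                   ≡⟨ cong (_+ (z % s + V (y + s))) (m∸n+n≡m (<⇒≤ s<t)) ⟨
        t ∸ s + s + (z % s + V (y + s))           ≡⟨ lem₆ (t ∸ s) s (z % s) _ ⟩
        l + V (y + s) + s                         ≡⟨ cong₂ (λ x w → x + V w + s) (count-B-below l≤t) (lem₇ u s _) ⟨
        count B? l + V (u + suc (z / s) * s) + s  ≤⟨ +-monoˡ-≤ s (windows-≤ b+V≡N f≤c (suc (z / s)) l l+[1+q]s≡z+t) ⟩
        N + s                                     ≡⟨ cong (_+ s) (trans (count-B M) (cong (t +_) count≡n)) ⟩
        t + n + s                                 ≡⟨ +-assoc t n s ⟩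
        t + (n + s)                               ∎)

    -- Reflection turns the count below `z + K` into `V (g + s)` minus `V` at the remaining distance
    -- to `g + s`. By `room` that distance is at least `u`, where `V u ≡ suc i`: `i` elements lie
    -- above `z`, and `z` itself is the extra one.
    few-below : ∀ {n g K} → count P? M ≡ n → V g ≡ n → W g → V (g + s) ≡ K + n →
                ∀ {z} → P z → z < M → count (δ? (g + s)) (z + K) ≤ K + count P? z
    few-below {n} {g} {K} count≡n Vg≡n Wg Vg+s {z} Pz z<M =
      let i , count-z+i≡n = m≤n⇒∃[o]m+o≡n count-z<n
          u , Vu≡1+i , f≤c = pivot z (s≤s z≤n) (b+i≡N count-z+i≡n)
          b+V≡N = trans (cong (count B? (z + t) +_) Vu≡1+i) (b+i≡N count-z+i≡n)
          o , z+K+u+o≡g+s = m≤n⇒∃[o]m+o≡n (room {z = z} count≡n Vg≡n Wg Vg+s b+V≡N f≤c)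
      in +-cancelʳ-≤ (suc i) _ _ (begin
        count (δ? (g + s)) (z + K) + suc i            ≡⟨ cong (count (δ? (g + s)) (z + K) +_) Vu≡1+i ⟨
        count (δ? (g + s)) (z + K) + V u              ≤⟨ +-monoʳ-≤ (count (δ? (g + s)) (z + K)) (count-mono W? (m≤m+n u o)) ⟩
        count (δ? (g + s)) (z + K) + V (u + o)        ≡⟨ δ-reflect (g + s) (z + K) (u + o) (trans (sym (+-assoc (z + K) u o)) z+K+u+o≡g+s) ⟩
        V (g + s)                                     ≡⟨ Vg+s ⟩
        K + n                                         ≡⟨ cong (K +_) count-z+i≡n ⟨
        K + (suc (count P? z) + i)                    ≡⟨ lem K _ i ⟨
        K + count P? z + suc i                        ∎)
      where
      open ≤-Reasoning
      lem : ∀ a b i → a + b + suc i ≡ a + (suc b + i)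
      lem = solve-∀
      count-z<n : count P? z < n
      count-z<n = subst₂ _≤_ (cong (_+ count P? z) (indicator-yes (P? z) Pz)) count≡n (count-mono P? z<M)
      b+i≡N : ∀ {i} → suc (count P? z) + i ≡ n → count B? (z + t) + suc i ≡ N
      b+i≡N {i} count-z+i≡n = begin-equality
        count B? (z + t) + suc i      ≡⟨ cong (λ p → count B? p + suc i) (+-comm z t) ⟩
        count B? (t + z) + suc i      ≡⟨ cong (_+ suc i) (count-B z) ⟩
        t + count P? z + suc i        ≡⟨ lem t _ i ⟩
        t + (suc (count P? z) + i)    ≡⟨ cong (t +_) (trans count-z+i≡n (sym count≡n)) ⟩
        t + count P? M                ≡⟨ count-B M ⟨
        N                             ∎

  -- From lists to predicates, and the conclusion.

  closed-shift : ∀ {β} o → (∀ x → x ∈ β → o < x → x ∸ o ∈ β) → ∀ {z} → suc (z + o) ∈ β → suc z ∈ β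
  closed-shift {β} o β-o {z} z+o∈ = subst (_∈ β) (m+n∸n≡m (suc z) o) (β-o _ z+o∈ (s≤s (m≤n+m o z)))

  betaSet-enumerate : ∀ {β} → IsBetaSet β → β ≡ enumerate (λ z → suc z ∈? β) (max 0 β)
  betaSet-enumerate {β} β-set@(_ , positive) = betaSet-unique β-set (enumerate-isBetaSet P? (max 0 β)) to from
    where
    P? : Decidable (λ z → suc z ∈ β)
    P? z = suc z ∈? β
    to : ∀ {x} → x ∈ β → x ∈ enumerate P? (max 0 β)
    to {zero}  x∈ with () ← All.lookup positive x∈
    to {suc z} x∈ = ∈-enumerate⁺ P? (max 0 β) (All.lookup (xs≤max 0 β) x∈) x∈
    from : ∀ {x} → x ∈ enumerate P? (max 0 β) → x ∈ β
    from x∈ with ∈-enumerate⁻ P? (max 0 β) x∈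
    ... | _ , refl , _ , z∈ = z∈

  closed-≺ : ∀ {n g} → W g → V g ≡ n → ∀ {β} → IsBetaSet β → IsClosed s t β → length β ≡ n →
             β ≺ delta (g + s)
  closed-≺ {n} {g} Wg Vg≡n {β} β-set β-closed len =
    subst (_≺ delta (g + s)) (sym (betaSet-enumerate β-set))
      (enumerate-≺ P? (δ? (g + s)) K
        (λ z∈β → few-below P? (closed-shift s λ x x∈ → proj₁ (β-closed x x∈))
                              (closed-shift t λ x x∈ → proj₂ (β-closed x x∈)) M
                              count≡n Vg≡n Wg Vg+s z∈β (All.lookup (xs≤max 0 β) z∈β))
        M (g + s) (trans (count-δ (g + s)) (trans Vg+s (cong (K +_) (sym count≡n)))))
    where
    M = max 0 β
    P? : Decidable (λ z → suc z ∈ β)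
    P? z = suc z ∈? β
    -- The surplus of `delta (g + s)` over the `n` elements of `β`; the subtraction is exact since
    -- `V g ≡ n`.
    K = V (g + s) ∸ n
    Vg+s : V (g + s) ≡ K + n
    Vg+s = sym (m∸n+n≡m (subst (_≤ V (g + s)) Vg≡n (count-mono W? (m≤m+n g s))))
    count≡n : count P? M ≡ n
    count≡n = trans (sym (length-enumerate P? M)) (trans (cong length (sym (betaSet-enumerate β-set))) len)

theorem4p2 : (s t n : ℕ) → 1 ≤ s → s < t → Coprime s t → 1 ≤ n →
    (MΔ : List ℕ) → IsMaxDelta s t n MΔ →
    (β : List ℕ) → IsBetaSet β → IsClosed s t β → length β ≡ n →
    Σ (List ℕ) λ C → Represents C (closure s t (MΔ +ₛ s)) × (β ≺ C)
theorem4p2 s t n 1≤s s<t coprime _ MΔ MΔ-max β β-set β-closed len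
  with Semigroup.maximal-delta s t 1≤s s<t coprime MΔ-max
... | g , 0<g , refl , Wg , Vg≡n =
  delta (g + s) , delta-shift-represents g 0<g , closed-≺ Wg Vg≡n β-set β-closed len
  where open Semigroup s t 1≤s s<t coprime
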